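{- Let $\alpha,\beta$ be real (or complex) parameters and let $n,k$ be non-negative integers. Then $$\genfrac{\lfloor}{\rfloor}{0pt}{}{n}{k}^{\alpha,\beta}=\sum_{j=0}^{n-k}(-1)^{j}\,\big((k+1)\beta+n\alpha\,|\,\beta\big)^{\overline{j}}\,\genfrac{\lfloor}{\rfloor}{0pt}{}{n+1}{k+j+1}^{\alpha,\beta},$$ where $(y|\theta)^{\overline{j}}=y(y+\theta)\cdots(y+(j-1)\theta)$ and $(y|\theta)^{\overline{0}}=1$; that is, $\big((k+1)\beta+n\alpha\,|\,\beta\big)^{\overline{j}}=\prod_{i=1}^{j}\big(n\alpha+(k+i)\beta\big)$.
   Context: For parameters $\alpha,\beta$, the generalized Stirling numbers $\genfrac{\lfloor}{\rfloor}{0pt}{}{n}{k}^{\alpha,\beta}$, $0\le k\le n$, are defined by the polynomial identity in $x$ $$x(x+\alpha)\cdots(x+(n-1)\alpha)=\sum_{k=0}^{n}\genfrac{\lfloor}{\rfloor}{0pt}{}{n}{k}^{\alpha,\beta}\,x(x-\beta)\cdots(x-(k-1)\beta),$$ (empty products equal $1$), and $\genfrac{\lfloor}{\rfloor}{0pt}{}{n}{k}^{\alpha,\beta}=0$ for $k<0$ or $k>n$. -}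

module Defs where

open import Algebra.Bundles using (CommutativeMonoid; CommutativeRing)
open import Algebra.Bundles.Raw using (RawRing)
import Algebra.Definitions.RawSemiring as RawSemiringDefinitions
import Algebra.Properties.Ring as RingProperties
import Algebra.Properties.Semiring.Sum as Sums
import Algebra.Properties.CommutativeSemigroup as CommutativeSemigroupProperties
open import Data.Fin.Base as Fin using (Fin; toℕ)
open import Data.Fin.Properties using (toℕ-fromℕ; toℕ-inject₁)
open import Data.List.Base using (List; []; _∷_; map)
open import Data.Nat.Base using (ℕ; zero; suc; _<_; s≤s)
open import Data.Nat.Properties using (≤-refl; m<n⇒m<1+n)
open import Level using (_⊔_)
open import Relation.Binary.PropositionalEquality as ≡ using ()
import Relation.Binary.Reasoning.Setoid as SetoidReasoning

module Factorials {c ℓ} (R : RawRing c ℓ) where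
  open RawRing R
  open RawSemiringDefinitions rawSemiring using (_×_)

  -- (y|θ)^{n̅} = y (y + θ) ⋯ (y + (n-1)θ)
  rising : Carrier → Carrier → ℕ → Carrier
  rising y θ zero    = 1#
  rising y θ (suc n) = rising y θ n * (y + n × θ)

  -- y (y - θ) ⋯ (y - (n-1)θ)
  falling : Carrier → Carrier → ℕ → Carrier
  falling y θ zero    = 1#
  falling y θ (suc n) = falling y θ n * (y + - (n × θ))

-- Formal polynomials in one variable: coefficient lists, constant term first,
-- compared coefficientwise (so trailing zeros are irrelevant).
module Polynomials {c ℓ} (R : CommutativeRing c ℓ) where
  open CommutativeRing R hiding (_-_; zero)

  Poly : Set c
  Poly = List Carrier

  coeff : Poly → ℕ → Carrier
  coeff []      _       = 0#
  coeff (a ∷ p) zero    = a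
  coeff (a ∷ p) (suc i) = coeff p i

  infix 4 _≈ₚ_
  _≈ₚ_ : Poly → Poly → Set ℓ
  p ≈ₚ q = ∀ i → coeff p i ≈ coeff q i

  infixl 6 _+ₚ_
  _+ₚ_ : Poly → Poly → Poly
  []      +ₚ q       = q
  (a ∷ p) +ₚ []      = a ∷ p
  (a ∷ p) +ₚ (b ∷ q) = a + b ∷ p +ₚ q

  infixl 7 _*ₚ_
  _*ₚ_ : Poly → Poly → Poly
  []      *ₚ q = []
  (a ∷ p) *ₚ q = map (a *_) q +ₚ (0# ∷ p *ₚ q)

  const : Carrier → Poly
  const a = a ∷ []

  X : Poly
  X = 0# ∷ 1# ∷ []

  polyRing : RawRing c ℓ
  polyRing = record
    { Carrier = Poly
    ; _≈_     = _≈ₚ_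
    ; _+_     = _+ₚ_
    ; _*_     = _*ₚ_
    ; -_      = map -_
    ; 0#      = []
    ; 1#      = const 1#
    }

-- Real and complex parameters are the instances R = ℝ and R = ℂ.
module GeneralizedStirling {c ℓ} (R : CommutativeRing c ℓ) where
  open CommutativeRing R hiding (_-_; zero)
  open Polynomials R public

  open RawSemiringDefinitions (RawRing.rawSemiring rawRing) public
    using (_×_; _^_; sum)
  open Factorials rawRing public
  open Factorials polyRing public
    renaming (rising to risingₚ; falling to fallingₚ)
  open RawSemiringDefinitions (RawRing.rawSemiring polyRing) public
    using () renaming (sum to sumₚ; _×_ to _×ₚ_)

  record IsGeneralizedStirling (α β : Carrier) (S : ℕ → ℕ → Carrier)
         : Set (c ⊔ ℓ) where
    field
      expansion : ∀ n →
        risingₚ X (const α) n ≈ₚ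
        sumₚ {suc n} (λ k → const (S n (toℕ k)) *ₚ fallingₚ X (const β) (toℕ k))
      vanishing : ∀ {n k} → n < k → S n k ≈ 0#

  -- IsGeneralizedStirling is satisfiable for all parameters: the numbers given
  -- by the triangular recurrence below have the defining property
  -- (stirling-isGeneralizedStirling).
  stirling : Carrier → Carrier → ℕ → ℕ → Carrier
  stirling α β zero    zero    = 1#
  stirling α β zero    (suc k) = 0#
  stirling α β (suc n) zero    = (n × α) * stirling α β n zero
  stirling α β (suc n) (suc k) =
    stirling α β n k + (suc k × β + n × α) * stirling α β n (suc k)

  private
    open SetoidReasoning setoid
    open RingProperties ring using (-0#≈0#; -‿distribˡ-*)
    open CommutativeSemigroupProperties
      (CommutativeMonoid.commutativeSemigroup *-commutativeMonoid)
      using (x∙yz≈y∙xz)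
    open CommutativeSemigroupProperties
      (CommutativeMonoid.commutativeSemigroup +-commutativeMonoid)
      using () renaming (x∙yz≈y∙xz to x+yz≈y+xz)
    open Sums semiring
      using (∑-distrib-+; *-distribˡ-sum; sum-cong-≋; sum-init-last)

    coeff-+ : ∀ p q i → coeff (p +ₚ q) i ≈ coeff p i + coeff q i
    coeff-+ []      q       i       = sym (+-identityˡ _)
    coeff-+ (a ∷ p) []      i       = sym (+-identityʳ _)
    coeff-+ (a ∷ p) (b ∷ q) zero    = refl
    coeff-+ (a ∷ p) (b ∷ q) (suc i) = coeff-+ p q i

    coeff-map-* : ∀ a p i → coeff (map (a *_) p) i ≈ a * coeff p i
    coeff-map-* a []      i       = sym (zeroʳ a)
    coeff-map-* a (b ∷ p) zero    = refl
    coeff-map-* a (b ∷ p) (suc i) = coeff-map-* a p i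

    coeff-neg : ∀ p i → coeff (map -_ p) i ≈ - coeff p i
    coeff-neg []      i       = sym -0#≈0#
    coeff-neg (b ∷ p) zero    = refl
    coeff-neg (b ∷ p) (suc i) = coeff-neg p i

    coeff-const-* : ∀ a p i → coeff (const a *ₚ p) i ≈ a * coeff p i
    coeff-const-* a p i = begin
      coeff (map (a *_) p +ₚ (0# ∷ [])) i          ≈⟨ coeff-+ (map (a *_) p) _ i ⟩
      coeff (map (a *_) p) i + coeff (0# ∷ []) i  ≈⟨ +-cong (coeff-map-* a p i) (coeff-0 i) ⟩
      a * coeff p i + 0#                          ≈⟨ +-identityʳ _ ⟩
      a * coeff p i                               ∎
      where
      coeff-0 : ∀ i → coeff (0# ∷ []) i ≈ 0#
      coeff-0 zero    = refl
      coeff-0 (suc i) = refl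

    coeff-sum : ∀ {n} (f : Fin n → Poly) i →
                coeff (sumₚ f) i ≈ sum (λ k → coeff (f k) i)
    coeff-sum {zero}  f i = refl
    coeff-sum {suc n} f i =
      trans (coeff-+ (f Fin.zero) _ i) (+-congˡ (coeff-sum (λ k → f (Fin.suc k)) i))

    record IsLinear (d : Carrier) (q : Poly) : Set ℓ where
      field
        at0  : coeff q 0 ≈ d
        at1  : coeff q 1 ≈ 1#
        at2+ : ∀ i → coeff q (suc (suc i)) ≈ 0#

    shift : (ℕ → Carrier) → ℕ → Carrier
    shift f zero    = 0#
    shift f (suc i) = f i

    coeff-*-linear : ∀ {d q} → IsLinear d q → ∀ p i →
                     coeff (p *ₚ q) i ≈ shift (coeff p) i + d * coeff p i
    coeff-*-linear {d} {q} lin []      zero    = sym (trans (+-identityˡ _) (zeroʳ d))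
    coeff-*-linear {d} {q} lin []      (suc i) = sym (trans (+-identityˡ _) (zeroʳ d))
    coeff-*-linear {d} {q} lin (a ∷ p) i =
      trans (coeff-+ (map (a *_) q) _ i) (trans (+-congʳ (coeff-map-* a q i)) (go i))
      where
      open IsLinear lin
      go : ∀ i → a * coeff q i + coeff (0# ∷ p *ₚ q) i ≈
                 shift (coeff (a ∷ p)) i + d * coeff (a ∷ p) i
      go zero = trans (+-comm _ _) (+-congˡ (trans (*-congˡ at0) (*-comm a d)))
      go (suc zero) = +-cong (trans (*-congˡ at1) (*-identityʳ a))
        (trans (coeff-*-linear lin p 0) (+-identityˡ _))
      go (suc (suc i)) = trans
        (+-cong (trans (*-congˡ (at2+ i)) (zeroʳ a)) (coeff-*-linear lin p (suc i)))
        (+-identityˡ _)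

    coeff-×-const-0 : ∀ n a → coeff (n ×ₚ const a) 0 ≈ n × a
    coeff-×-const-0 zero    a = refl
    coeff-×-const-0 (suc n) a =
      trans (coeff-+ (const a) (n ×ₚ const a) 0) (+-congˡ (coeff-×-const-0 n a))

    coeff-×-const-suc : ∀ n a i → coeff (n ×ₚ const a) (suc i) ≈ 0#
    coeff-×-const-suc zero    a i = refl
    coeff-×-const-suc (suc n) a i =
      trans (coeff-+ (const a) (n ×ₚ const a) (suc i))
            (trans (+-identityˡ _) (coeff-×-const-suc n a i))

    X+-linear : ∀ {d} q → coeff q 0 ≈ d → (∀ i → coeff q (suc i) ≈ 0#) →
                IsLinear d (X +ₚ q)
    X+-linear q q₀ qₛ = record
      { at0  = trans (coeff-+ X q 0) (trans (+-identityˡ _) q₀)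
      ; at1  = trans (coeff-+ X q 1) (trans (+-congˡ (qₛ 0)) (+-identityʳ _))
      ; at2+ = λ i → trans (coeff-+ X q (suc (suc i))) (trans (+-identityˡ _) (qₛ (suc i)))
      }

    coeff-rising : ∀ α n i → coeff (risingₚ X (const α) (suc n)) i ≈
      shift (coeff (risingₚ X (const α) n)) i + (n × α) * coeff (risingₚ X (const α) n) i
    coeff-rising α n = coeff-*-linear
      (X+-linear (n ×ₚ const α) (coeff-×-const-0 n α) (coeff-×-const-suc n α))
      (risingₚ X (const α) n)

    coeff-falling : ∀ β k i → coeff (fallingₚ X (const β) (suc k)) i ≈
      shift (coeff (fallingₚ X (const β) k)) i +
      - (k × β) * coeff (fallingₚ X (const β) k) i
    coeff-falling β k = coeff-*-linear
      (X+-linear (map -_ (k ×ₚ const β))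
        (trans (coeff-neg (k ×ₚ const β) 0) (-‿cong (coeff-×-const-0 k β)))
        (λ i → trans (coeff-neg (k ×ₚ const β) (suc i))
                     (trans (-‿cong (coeff-×-const-suc k β i)) -0#≈0#)))
      (fallingₚ X (const β) k)

    stirling-vanishes : ∀ α β {n k} → n < k → stirling α β n k ≈ 0#
    stirling-vanishes α β {zero}  {suc k} _         = refl
    stirling-vanishes α β {suc n} {suc k} (s≤s n<k) = trans
      (+-cong (stirling-vanishes α β n<k)
              (trans (*-congˡ (stirling-vanishes α β (m<n⇒m<1+n n<k))) (zeroʳ _)))
      (+-identityˡ _)

    shift-sum : ∀ {n} (a : Fin n → Carrier) (f : Fin n → ℕ → Carrier) i →
                shift (λ j → sum (λ k → a k * f k j)) i ≈ sum (λ k → a k * shift (f k) i)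
    shift-sum {zero}  a f zero    = refl
    shift-sum {suc n} a f zero    = sym (trans
      (+-cong (zeroʳ _) (sym (shift-sum (λ k → a (Fin.suc k)) (λ k → f (Fin.suc k)) zero)))
      (+-identityˡ _))
    shift-sum a f (suc i) = refl

    shift-cong : ∀ {f g : ℕ → Carrier} → (∀ i → f i ≈ g i) → ∀ i → shift f i ≈ shift g i
    shift-cong f≈g zero    = refl
    shift-cong f≈g (suc i) = f≈g i

    sum-last : ∀ n (g : ℕ → Carrier) →
               sum {suc n} (λ k → g (toℕ k)) ≈ sum {n} (λ k → g (toℕ k)) + g n
    sum-last n g = trans (sum-init-last {n} (λ k → g (toℕ k)))
      (+-cong (sum-cong-≋ {n} (λ k → reflexive (≡.cong g (toℕ-inject₁ k))))
              (reflexive (≡.cong g (toℕ-fromℕ n))))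

    module Expansion (α β : Carrier) where
      r : ℕ → ℕ → Carrier
      r n = coeff (risingₚ X (const α) n)

      f : ℕ → ℕ → Carrier
      f k = coeff (fallingₚ X (const β) k)

      S : ℕ → ℕ → Carrier
      S = stirling α β

      shift-f : ∀ k i → shift (f k) i ≈ f (suc k) i + (k × β) * f k i
      shift-f k i = sym (begin
        f (suc k) i + b * f k i                     ≈⟨ +-congʳ (coeff-falling β k i) ⟩
        shift (f k) i + - b * f k i + b * f k i     ≈⟨ +-assoc _ _ _ ⟩
        shift (f k) i + (- b * f k i + b * f k i)   ≈⟨ +-congˡ (+-congʳ (sym (-‿distribˡ-* b (f k i)))) ⟩
        shift (f k) i + (- (b * f k i) + b * f k i) ≈⟨ +-congˡ (-‿inverseˡ _) ⟩
        shift (f k) i + 0#                          ≈⟨ +-identityʳ _ ⟩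
        shift (f k) i                               ∎)
        where b = k × β

      term : ∀ n k i → S n k * shift (f k) i + (n × α) * (S n k * f k i) ≈
                       S n k * f (suc k) i + ((k × β + n × α) * S n k) * f k i
      term n k i = begin
        s * shift (f k) i + a * (s * f k i)             ≈⟨ +-congʳ (*-congˡ (shift-f k i)) ⟩
        s * (f (suc k) i + b * f k i) + a * (s * f k i) ≈⟨ +-congʳ (distribˡ s _ _) ⟩
        s * f (suc k) i + s * (b * f k i) + a * (s * f k i)
          ≈⟨ +-assoc _ _ _ ⟩
        s * f (suc k) i + (s * (b * f k i) + a * (s * f k i))
          ≈⟨ +-congˡ (+-congʳ (x∙yz≈y∙xz s b _)) ⟩
        s * f (suc k) i + (b * (s * f k i) + a * (s * f k i))
          ≈⟨ +-congˡ (sym (distribʳ _ b a)) ⟩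
        s * f (suc k) i + (b + a) * (s * f k i)         ≈⟨ +-congˡ (sym (*-assoc _ _ _)) ⟩
        s * f (suc k) i + ((b + a) * s) * f k i         ∎
        where
        s = S n k
        a = n × α
        b = k × β

      step : ∀ n i →
        sum {suc n} (λ k → S n (toℕ k) * f (suc (toℕ k)) i +
                           ((toℕ k × β + n × α) * S n (toℕ k)) * f (toℕ k) i) ≈
        sum {suc (suc n)} (λ k → S (suc n) (toℕ k) * f (toℕ k) i)
      step n i = begin
        sum {suc n} (λ k → u (toℕ k) + v (toℕ k))
          ≈⟨ ∑-distrib-+ {suc n} (λ k → u (toℕ k)) (λ k → v (toℕ k)) ⟩
        sum {suc n} (λ k → u (toℕ k)) + sum {suc n} (λ k → v (toℕ k))
          ≈⟨ +-congˡ (sym (trans (sum-last (suc n) v) (trans (+-congˡ v-last) (+-identityʳ _)))) ⟩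
        sum {suc n} (λ k → u (toℕ k)) + (v 0 + sum {suc n} (λ k → v (suc (toℕ k))))
          ≈⟨ x+yz≈y+xz _ _ _ ⟩
        v 0 + (sum {suc n} (λ k → u (toℕ k)) + sum {suc n} (λ k → v (suc (toℕ k))))
          ≈⟨ +-cong (*-congʳ (*-congʳ (+-identityˡ _)))
               (trans (sym (∑-distrib-+ {suc n} (λ k → u (toℕ k)) (λ k → v (suc (toℕ k)))))
                      (sum-cong-≋ {suc n} (λ k → sym
                        (distribʳ (f (suc (toℕ k)) i) (S n (toℕ k))
                                  ((suc (toℕ k) × β + n × α) * S n (suc (toℕ k))))))) ⟩
        sum {suc (suc n)} (λ k → S (suc n) (toℕ k) * f (toℕ k) i) ∎
        where
        u v : ℕ → Carrier
        u k = S n k * f (suc k) i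
        v k = ((k × β + n × α) * S n k) * f k i
        v-last : v (suc n) ≈ 0#
        v-last = trans
          (*-congʳ (trans (*-congˡ (stirling-vanishes α β {n} ≤-refl)) (zeroʳ _)))
          (zeroˡ _)

      expand : ∀ n i → r n i ≈ sum {suc n} (λ k → S n (toℕ k) * f (toℕ k) i)
      expand zero    i = sym (trans (+-identityʳ _) (*-identityˡ _))
      expand (suc n) i = begin
        r (suc n) i                        ≈⟨ coeff-rising α n i ⟩
        shift (r n) i + (n × α) * r n i    ≈⟨ +-cong
          (trans (shift-cong (expand n) i)
                 (shift-sum {suc n} (λ k → S n (toℕ k)) (λ k → f (toℕ k)) i))
          (trans (*-congˡ (expand n i)) (*-distribˡ-sum {suc n} (n × α) (λ k → S n (toℕ k) * f (toℕ k) i))) ⟩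
        sum {suc n} (λ k → S n (toℕ k) * shift (f (toℕ k)) i) +
        sum {suc n} (λ k → (n × α) * (S n (toℕ k) * f (toℕ k) i))
          ≈⟨ sym (∑-distrib-+ {suc n} (λ k → S n (toℕ k) * shift (f (toℕ k)) i)
                                  (λ k → (n × α) * (S n (toℕ k) * f (toℕ k) i))) ⟩
        sum {suc n} (λ k → S n (toℕ k) * shift (f (toℕ k)) i +
                           (n × α) * (S n (toℕ k) * f (toℕ k) i))
          ≈⟨ sum-cong-≋ {suc n} (λ k → term n (toℕ k) i) ⟩
        sum {suc n} (λ k → S n (toℕ k) * f (suc (toℕ k)) i +
                           ((toℕ k × β + n × α) * S n (toℕ k)) * f (toℕ k) i)
          ≈⟨ step n i ⟩
        sum {suc (suc n)} (λ k → S (suc n) (toℕ k) * f (toℕ k) i) ∎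

  stirling-isGeneralizedStirling : ∀ α β → IsGeneralizedStirling α β (stirling α β)
  stirling-isGeneralizedStirling α β = record
    { expansion = λ n i → trans (Expansion.expand α β n i) (sym (trans
        (coeff-sum {suc n} (λ k → const (stirling α β n (toℕ k)) *ₚ fallingₚ X (const β) (toℕ k)) i)
        (sum-cong-≋ {suc n} (λ k → coeff-const-* (stirling α β n (toℕ k)) (fallingₚ X (const β) (toℕ k)) i))))
    ; vanishing = stirling-vanishes α β
    }

{-# OPTIONS --safe #-}
-- Uniqueness of the expansion in the monic polynomials x(x-β)⋯(x-(k-1)β) gives
-- S(n+1,m+1) = S(n,m) + ((m+1)β + nα) S(n,m+1).  Put
-- T(j) = (-1)^j ((k+1)β + nα|β)^{j̅} S(n,k+j).  The recurrence turns the j-th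
-- summand into T(j) - T(j+1), so the sum telescopes to T(0) = S(n,k), because
-- T(n+1-k) contains S(n,k+(n+1-k)) = 0.
module Submission where

open import Defs
open import Algebra.Bundles using (CommutativeRing)
open import Data.Fin.Base using (toℕ)
open import Data.Nat.Base as ℕ using (ℕ; suc; _∸_)

open import Algebra.Bundles using (CommutativeMonoid)
import Algebra.Properties.CommutativeSemigroup as CommutativeSemigroupProperties
import Algebra.Properties.Monoid.Mult as Multiples
import Algebra.Properties.Ring as RingProperties
import Algebra.Properties.Semiring.Sum as Sums
open import Data.Fin.Base as Fin using (Fin)
open import Data.Fin.Properties using (toℕ<n; toℕ-fromℕ; toℕ-inject₁)
open import Data.List.Base using ([]; _∷_; map)
open import Data.Nat.Base using (zero; _<_; s≤s; z<s; s<s)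
import Data.Nat.Properties as ℕₚ
open import Data.Sum.Base using (_⊎_; inj₁; inj₂)
open import Function.Base using (_∘_)
open import Relation.Binary.PropositionalEquality as ≡ using (_≡_)
import Relation.Binary.Reasoning.Setoid as SetoidReasoning
open import Relation.Nullary.Decidable using (yes; no)

-- Finite sums: telescoping, and uniqueness of coefficients in a unitriangular family.

module SumProperties {c ℓ} (R : CommutativeRing c ℓ) where
  open CommutativeRing R hiding (zero)
  open Sums semiring
  open RingProperties ring using (+-cancelʳ)
  open SetoidReasoning setoid

  sum-last : ∀ n (g : ℕ → Carrier) →
             sum {suc n} (g ∘ toℕ) ≈ sum {n} (g ∘ toℕ) + g n
  sum-last n g = trans (sum-init-last {n} (g ∘ toℕ))
    (+-cong (sum-cong-≋ {n} (λ k → reflexive (≡.cong g (toℕ-inject₁ k))))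
            (reflexive (≡.cong g (toℕ-fromℕ n))))

  sum-zero : ∀ {n} (t : Fin n → Carrier) → (∀ k → t k ≈ 0#) → sum t ≈ 0#
  sum-zero {n} t t≈0 = trans (sum-cong-≋ {n} t≈0) (sum-replicate-zero n)

  -- The difference `T j - T (suc j)` is kept in additive form. As `sum` unfolds at its head, the
  -- induction shifts both `T` and `g` by one and closes with `step 0`.
  sum-telescope : (T g : ℕ → Carrier) → (∀ j → g j + T (suc j) ≈ T j) →
                  ∀ m → sum {m} (g ∘ toℕ) + T m ≈ T 0
  sum-telescope T g step zero    = +-identityˡ _
  sum-telescope T g step (suc m) = begin
    g 0 + sum {m} (g ∘ suc ∘ toℕ) + T (suc m)   ≈⟨ +-assoc _ _ _ ⟩
    g 0 + (sum {m} (g ∘ suc ∘ toℕ) + T (suc m)) ≈⟨ +-congˡ (sum-telescope (T ∘ suc) (g ∘ suc) (step ∘ suc) m) ⟩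
    g 0 + T 1                                   ≈⟨ step 0 ⟩
    T 0                                         ∎

  -- The model for `f k` is the coefficient sequence of a monic polynomial of degree `k`.
  module _ (f : ℕ → ℕ → Carrier)
           (diagonal : ∀ k → f k k ≈ 1#)
           (triangular : ∀ {k i} → k < i → f k i ≈ 0#) where

    private
      combination : ℕ → (ℕ → Carrier) → ℕ → Carrier
      combination n a i = sum {n} (λ k → a (toℕ k) * f (toℕ k) i)

    combination-at-last : ∀ n a → combination (suc n) a n ≈ a n
    combination-at-last n a = begin
      combination (suc n) a n         ≈⟨ sum-last n (λ k → a k * f k n) ⟩
      combination n a n + a n * f n n ≈⟨ +-cong
        (sum-zero {n} _ (λ k → trans (*-congˡ (triangular (toℕ<n k))) (zeroʳ _)))
        (trans (*-congˡ (diagonal n)) (*-identityʳ _)) ⟩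
      0# + a n                        ≈⟨ +-identityˡ _ ⟩
      a n                             ∎

    -- Column `n` sees only the last of `suc n` rows, with entry 1, so the last coefficients agree
    -- without any division. Cancelling the last terms leaves the same claim for one row fewer.
    unitriangular-injective : ∀ n (a b : ℕ → Carrier) →
      (∀ i → combination n a i ≈ combination n b i) →
      ∀ {k} → k < n → a k ≈ b k
    unitriangular-injective (suc n) a b a≈b k<1+n = case (ℕₚ.m<1+n⇒m<n∨m≡n k<1+n)
      where
      last : a n ≈ b n
      last = trans (sym (combination-at-last n a)) (trans (a≈b n) (combination-at-last n b))
      init : ∀ i → combination n a i ≈ combination n b i
      init i = +-cancelʳ (a n * f n i) _ _ (begin
        combination n a i + a n * f n i ≈⟨ sum-last n (λ k → a k * f k i) ⟨
        combination (suc n) a i         ≈⟨ a≈b i ⟩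
        combination (suc n) b i         ≈⟨ sum-last n (λ k → b k * f k i) ⟩
        combination n b i + b n * f n i ≈⟨ +-congˡ (*-congʳ last) ⟨
        combination n b i + a n * f n i ∎)
      case : ∀ {k} → k < n ⊎ k ≡ n → a k ≈ b k
      case (inj₁ k<n)    = unitriangular-injective n a b init k<n
      case (inj₂ ≡.refl) = last

-- Coefficients of polynomials, and monicity of the falling factorials.

module PolynomialProperties {c ℓ} (R : CommutativeRing c ℓ) where
  open CommutativeRing R hiding (zero)
  open GeneralizedStirling R
  open RingProperties ring using (-0#≈0#)

  coeff-+ : ∀ p q i → coeff (p +ₚ q) i ≈ coeff p i + coeff q i
  coeff-+ []      q       i       = sym (+-identityˡ _)
  coeff-+ (a ∷ p) []      i       = sym (+-identityʳ _)
  coeff-+ (a ∷ p) (b ∷ q) zero    = refl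
  coeff-+ (a ∷ p) (b ∷ q) (suc i) = coeff-+ p q i

  coeff-map-* : ∀ a p i → coeff (map (a *_) p) i ≈ a * coeff p i
  coeff-map-* a []      i       = sym (zeroʳ a)
  coeff-map-* a (b ∷ p) zero    = refl
  coeff-map-* a (b ∷ p) (suc i) = coeff-map-* a p i

  coeff-neg : ∀ p i → coeff (map -_ p) i ≈ - coeff p i
  coeff-neg []      i       = sym -0#≈0#
  coeff-neg (b ∷ p) zero    = refl
  coeff-neg (b ∷ p) (suc i) = coeff-neg p i

  coeff-∷-* : ∀ a p q i →
    coeff ((a ∷ p) *ₚ q) i ≈ a * coeff q i + coeff (0# ∷ p *ₚ q) i
  coeff-∷-* a p q i = trans (coeff-+ (map (a *_) q) _ i) (+-congʳ (coeff-map-* a q i))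

  coeff-const-* : ∀ a q i → coeff (const a *ₚ q) i ≈ a * coeff q i
  coeff-const-* a q i = trans (coeff-∷-* a [] q i) (trans (+-congˡ (0∷[]≈0 i)) (+-identityʳ _))
    where
    0∷[]≈0 : ∀ i → coeff (0# ∷ []) i ≈ 0#
    0∷[]≈0 zero    = refl
    0∷[]≈0 (suc i) = refl

  coeff-sum : ∀ {n} (f : Fin n → Poly) i →
              coeff (sumₚ f) i ≈ sum (λ k → coeff (f k) i)
  coeff-sum {zero}  f i = refl
  coeff-sum {suc n} f i =
    trans (coeff-+ (f Fin.zero) _ i) (+-congˡ (coeff-sum (f ∘ Fin.suc) i))

  coeff-×-const-suc : ∀ n a i → coeff (n ×ₚ const a) (suc i) ≈ 0#
  coeff-×-const-suc zero    a i = refl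
  coeff-×-const-suc (suc n) a i = trans (coeff-+ (const a) (n ×ₚ const a) (suc i))
    (trans (+-identityˡ _) (coeff-×-const-suc n a i))

  -- The degree is a parameter because a coefficient list may end in zeros, so its length does not
  -- give the degree.
  record IsMonic (n : ℕ) (p : Poly) : Set ℓ where
    field
      leading : coeff p n ≈ 1#
      above   : ∀ {i} → n < i → coeff p i ≈ 0#

  open IsMonic

  X+const-monic : ∀ q → (∀ i → coeff q (suc i) ≈ 0#) → IsMonic 1 (X +ₚ q)
  X+const-monic q q≈0 .leading = trans (coeff-+ X q 1) (trans (+-congˡ (q≈0 0)) (+-identityʳ _))
  X+const-monic q q≈0 .above {suc (suc i)} _ =
    trans (coeff-+ X q (suc (suc i))) (trans (+-identityˡ _) (q≈0 (suc i)))
  X+const-monic q q≈0 .above {suc zero} (s≤s ())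

  -- Only the coefficients of `q` at 1 (which is 1) and at 0 contribute. Positive indices suffice
  -- for reading off the leading coefficient and those above it.
  coeff-*-linear : ∀ {q} → IsMonic 1 q → ∀ p i →
    coeff (p *ₚ q) (suc i) ≈ coeff p i + coeff p (suc i) * coeff q 0
  coeff-*-linear {q} q-monic [] i = sym (trans (+-identityˡ _) (zeroˡ _))
  coeff-*-linear {q} q-monic (a ∷ p) i = trans (coeff-∷-* a p q (suc i)) (go p i)
    where
    go : ∀ p i → a * coeff q (suc i) + coeff (p *ₚ q) i ≈
         coeff (a ∷ p) i + coeff p i * coeff q 0
    go p zero = +-cong (trans (*-congˡ (leading q-monic)) (*-identityʳ a)) (head p)
      where
      head : ∀ p → coeff (p *ₚ q) 0 ≈ coeff p 0 * coeff q 0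
      head []      = sym (zeroˡ _)
      head (b ∷ p) = trans (coeff-∷-* b p q 0) (+-identityʳ _)
    -- Here `a` meets a coefficient of `q` beyond degree 1, so only the product with the tail `p`
    -- survives.
    go p (suc i) = trans
      (+-cong (trans (*-congˡ (above q-monic (s<s z<s))) (zeroʳ a)) (coeff-*-linear q-monic p i))
      (+-identityˡ _)

  *-linear-monic : ∀ {n p q} → IsMonic n p → IsMonic 1 q → IsMonic (suc n) (p *ₚ q)
  *-linear-monic {n} {p} p-monic q-monic .leading =
    trans (coeff-*-linear q-monic p n)
      (trans (+-cong (leading p-monic) (trans (*-congʳ (above p-monic ℕₚ.≤-refl)) (zeroˡ _)))
             (+-identityʳ _))
  *-linear-monic {n} {p} p-monic q-monic .above {suc i} (s≤s n<i) =
    trans (coeff-*-linear q-monic p i)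
      (trans (+-cong (above p-monic n<i) (trans (*-congʳ (above p-monic (ℕₚ.m<n⇒m<1+n n<i))) (zeroˡ _)))
             (+-identityʳ _))

  falling-monic : ∀ β k → IsMonic k (fallingₚ X (const β) k)
  falling-monic β zero    = record { leading = refl ; above = λ { (s≤s _) → refl } }
  falling-monic β (suc k) = *-linear-monic (falling-monic β k) (X+const-monic (map -_ (k ×ₚ const β)) λ i →
    trans (coeff-neg (k ×ₚ const β) (suc i))
          (trans (-‿cong (coeff-×-const-suc k β i)) -0#≈0#))

-- Uniqueness of the numbers, their triangular recurrence, and the algebra of one telescoping step.

module StirlingProperties {c ℓ} (R : CommutativeRing c ℓ) where
  open CommutativeRing R hiding (zero)
  open GeneralizedStirling R
  open SumProperties R
  open PolynomialProperties R
  open Sums semiring using (sum-cong-≋)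
  open Multiples +-monoid using (×-homo-+)
  open RingProperties ring using (-1*x≈-x)
  open CommutativeSemigroupProperties
    (CommutativeMonoid.commutativeSemigroup +-commutativeMonoid)
    using (xy∙z≈xz∙y)
  open SetoidReasoning setoid

  module _ {α β : Carrier} where
    open IsGeneralizedStirling

    coeff-expansion : ∀ {S} → IsGeneralizedStirling α β S → ∀ n i →
      coeff (risingₚ X (const α) n) i ≈
      sum {suc n} (λ k → S n (toℕ k) * coeff (fallingₚ X (const β) (toℕ k)) i)
    coeff-expansion {S} isS n i = trans (expansion isS n i) (trans
      (coeff-sum {suc n} (λ k → const (S n (toℕ k)) *ₚ fallingₚ X (const β) (toℕ k)) i)
      (sum-cong-≋ {suc n} (λ k → coeff-const-* (S n (toℕ k)) (fallingₚ X (const β) (toℕ k)) i)))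

    -- For `k ≤ n` both families expand the same rising factorial in the monic falling factorials;
    -- for `k > n` both vanish by definition.
    isGeneralizedStirling-unique : ∀ {S S′} →
      IsGeneralizedStirling α β S → IsGeneralizedStirling α β S′ →
      ∀ n k → S n k ≈ S′ n k
    isGeneralizedStirling-unique {S} {S′} isS isS′ n k with k ℕₚ.<? suc n
    ... | yes k≤n = unitriangular-injective
      (λ k → coeff (fallingₚ X (const β) k))
      (λ k → IsMonic.leading (falling-monic β k))
      (λ {k} → IsMonic.above (falling-monic β k))
      (suc n) (S n) (S′ n)
      (λ i → trans (sym (coeff-expansion isS n i)) (coeff-expansion isS′ n i))
      k≤n
    ... | no k≰n = trans (vanishing isS n<k) (sym (vanishing isS′ n<k))
      where
      n<k : n < k
      n<k = ℕₚ.≮⇒≥ k≰n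

    -- For `stirling` this holds by definition; uniqueness carries it over to `S`.
    recurrence : ∀ {S} → IsGeneralizedStirling α β S → ∀ n k →
      S (suc n) (suc k) ≈ S n k + (suc k × β + n × α) * S n (suc k)
    recurrence isS n k = trans (unique (suc n) (suc k))
      (sym (+-cong (unique n k) (*-congˡ (unique n (suc k)))))
      where
      unique = isGeneralizedStirling-unique isS (stirling-isGeneralizedStirling α β)

  -- The left side is the factor that `rising` gains from `j` to `suc j`, the right side the weight
  -- in the recurrence at column `suc (k + j)`. Their agreement is what makes the sum telescope.
  weight-shift : ∀ α β n k j →
    suc k × β + n × α + j × β ≈ suc (k ℕ.+ j) × β + n × α
  weight-shift α β n k j =
    trans (xy∙z≈xz∙y _ _ _) (+-congʳ (sym (×-homo-+ β (suc k) j)))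

  -- Here `e` is the sign, `r` the product of the first `j` factors, `w` the next factor, and `s`,
  -- `t` are neighbouring numbers in row `n`. The extra factor `- 1#` makes the two `w * t`
  -- contributions cancel.
  cancel-next : ∀ e r w s t →
    e * r * (s + w * t) + (- 1# * e) * (r * w) * t ≈ e * r * s
  cancel-next e r w s t = begin
    e * r * (s + w * t) + (- 1# * e) * (r * w) * t     ≈⟨ +-cong (distribˡ _ _ _) regroup ⟩
    e * r * s + e * r * (w * t) + - (e * r * (w * t))  ≈⟨ +-assoc _ _ _ ⟩
    e * r * s + (e * r * (w * t) + - (e * r * (w * t))) ≈⟨ +-congˡ (-‿inverseʳ _) ⟩
    e * r * s + 0#                                     ≈⟨ +-identityʳ _ ⟩
    e * r * s                                          ∎
    where
    regroup : (- 1# * e) * (r * w) * t ≈ - (e * r * (w * t))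
    regroup = begin
      (- 1# * e) * (r * w) * t   ≈⟨ *-congʳ (*-assoc _ _ _) ⟩
      - 1# * (e * (r * w)) * t   ≈⟨ *-assoc _ _ _ ⟩
      - 1# * (e * (r * w) * t)   ≈⟨ -1*x≈-x _ ⟩
      - (e * (r * w) * t)        ≈⟨ -‿cong (*-congʳ (*-assoc e r w)) ⟨
      - (e * r * w * t)          ≈⟨ -‿cong (*-assoc (e * r) w t) ⟩
      - (e * r * (w * t))        ∎

theorem4 : ∀ {c ℓ} (R : CommutativeRing c ℓ) →
    let open CommutativeRing R
        open GeneralizedStirling R
    in
    (α β : Carrier) (S : ℕ → ℕ → Carrier) → IsGeneralizedStirling α β S →
    (n k : ℕ) →
    S n k ≈
      sum {suc n ∸ k} (λ j →
        (- 1#) ^ toℕ j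
        * rising (suc k × β + n × α) β (toℕ j)
        * S (suc n) (k ℕ.+ toℕ j ℕ.+ 1))
theorem4 R α β S isS n k = sym (begin
  sum {m} (g ∘ toℕ)        ≈⟨ +-identityʳ _ ⟨
  sum {m} (g ∘ toℕ) + 0#   ≈⟨ +-congˡ T-last ⟨
  sum {m} (g ∘ toℕ) + T m  ≈⟨ sum-telescope T g step m ⟩
  -- At `j = 0` both the sign and the rising factorial are empty products.
  T 0                      ≈⟨ *-congʳ (*-identityˡ 1#) ⟩
  1# * S n (k ℕ.+ 0)       ≈⟨ *-identityˡ _ ⟩
  S n (k ℕ.+ 0)            ≡⟨ ≡.cong (S n) (ℕₚ.+-identityʳ k) ⟩
  S n k                    ∎)
  where
  open CommutativeRing R
  open GeneralizedStirling R
  open SumProperties R using (sum-telescope)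
  open StirlingProperties R
  open SetoidReasoning setoid

  -- Truncated subtraction makes the sum empty when `k > n`, where `S n k` is zero as well.
  m = suc n ∸ k

  ρ T g : ℕ → Carrier
  ρ = rising (suc k × β + n × α) β
  T j = (- 1#) ^ j * ρ j * S n (k ℕ.+ j)
  g j = (- 1#) ^ j * ρ j * S (suc n) (k ℕ.+ j ℕ.+ 1)

  T-last : T m ≈ 0#
  T-last = trans
    -- The bound `n < k + m` holds even when the subtraction in `m` truncates.
    (*-congˡ (IsGeneralizedStirling.vanishing isS (ℕₚ.m≤n+m∸n (suc n) k)))
    (zeroʳ _)

  step : ∀ j → g j + T (suc j) ≈ T j
  step j = begin
    g j + T (suc j)
      -- Both column indices, `k + j + 1` and `k + suc j`, become `suc (k + j)`, the form the
      -- recurrence uses.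
      ≡⟨ ≡.cong₂ (λ a b → e * ρ j * S (suc n) a + (- 1# * e) * ρ (suc j) * S n b)
           (ℕₚ.+-comm (k ℕ.+ j) 1) (ℕₚ.+-suc k j) ⟩
    e * ρ j * S (suc n) (suc (k ℕ.+ j)) + (- 1# * e) * ρ (suc j) * S n (suc (k ℕ.+ j))
      ≈⟨ +-cong (*-congˡ (recurrence isS n (k ℕ.+ j)))
                (*-congʳ (*-congˡ (*-congˡ (weight-shift α β n k j)))) ⟩
    e * ρ j * (S n (k ℕ.+ j) + w * S n (suc (k ℕ.+ j))) + (- 1# * e) * (ρ j * w) * S n (suc (k ℕ.+ j))
      ≈⟨ cancel-next e (ρ j) w _ _ ⟩
    T j ∎
    where
    e = (- 1#) ^ j
    w = suc (k ℕ.+ j) × β + n × α
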